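{- For every integer $n\geq 5$, the eccentricity matrix $E(W_n)$ of the wheel graph $W_n$ on $n$ vertices is not a Euclidean distance matrix.
   Context: A real square matrix $M=(m_{ij})$ of order $n$ is a Euclidean distance matrix if there exist (for some $r$) $n$ vectors $\mathbf{x_1},\dots,\mathbf{x_n}\in\mathbb{R}^r$ such that $m_{ij}=\|\mathbf{x_i}-\mathbf{x_j}\|_2^2$ for all $i,j$, where $\|\cdot\|_2$ is the Euclidean norm. For a simple connected graph $G$ with vertices $v_1,\dots,v_n$, let $d(v_i,v_j)$ be the length of a shortest path between $v_i$ and $v_j$, and let $e(v_i)=\max\{d(v_i,v_j):1\le j\le n\}$ be the eccentricity of $v_i$. The eccentricity matrix $E(G)$ is the $n\times n$ real matrix with $(E(G))_{ij}=d(v_i,v_j)$ if $d(v_i,v_j)=\min\{e(v_i),e(v_j)\}$, and $(E(G))_{ij}=0$ otherwise. The wheel graph $W_n$ is the graph on $n$ vertices consisting of a cycle of length $n-1$ together with one further vertex (the hub) adjacent to every vertex of the cycle. The vertices are labelled so that $v_1$ is the hub and $v_2,\dots,v_n$ are the cycle vertices in cyclic order. -}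

module Defs where

open import Data.Bool using (if_then_else_)
open import Data.Empty using (⊥-elim)
open import Data.Fin as Fin using (Fin; zero; suc; toℕ)
import Data.Fin.Properties as Fin
open import Data.Integer using (+_)
open import Data.List using (tabulate)
open import Data.List.Extrema.Nat using (max)
open import Data.Nat as ℕ using (ℕ; zero; suc; _⊓_; _⊔_; s≤s)
import Data.Nat.Properties as ℕ
open import Data.Product using (∃; Σ; _×_; _,_; proj₁; proj₂)
open import Data.Rational as ℚ using (ℚ; 0ℚ; 1ℚ; ½; ∣_∣; Positive)
import Data.Rational.Properties as ℚ
open import Data.Rational.Solver using (module +-*-Solver)
open import Data.Sum using (_⊎_; inj₁; inj₂; swap)
open import Data.Vec as Vec using (Vec; []; _∷_)
open import Data.Vec.Functional using (Vector; foldr)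
open import Data.Vec.Relation.Unary.All using ([]; _∷_)
open import Data.Vec.Relation.Unary.AllPairs using ([]; _∷_; allPairs?)
open import Data.Vec.Relation.Unary.Linked using (Linked; [-]; _∷_; linked?)
open import Data.Vec.Relation.Unary.Unique.Propositional using (Unique)
open import Relation.Binary using (Rel; Symmetric; Irreflexive; Decidable)
open import Relation.Binary.PropositionalEquality
open import Relation.Nullary using (¬_; Dec; yes; no)
open import Relation.Nullary.Decidable using (map′; _×-dec_; _⊎-dec_; ¬?; ⌊_⌋)
open import Level using (0ℓ)

-- The reals as Cauchy sequences of rationals (the proof of IsCauchy carries
-- a modulus).  Equality of reals is _≈_, never _≡_.

IsCauchy : (ℕ → ℚ) → Set
IsCauchy x = ∀ ε → 0ℚ ℚ.< ε →
  ∃ λ N → ∀ m n → N ℕ.≤ m → N ℕ.≤ n → ∣ x m ℚ.- x n ∣ ℚ.< ε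

record ℝ : Set where
  constructor mkℝ
  field
    approx : ℕ → ℚ
    cauchy : IsCauchy approx

open ℝ public

infix 4 _≈_

_≈_ : ℝ → ℝ → Set
x ≈ y = ∀ ε → 0ℚ ℚ.< ε →
  ∃ λ N → ∀ n → N ℕ.≤ n → ∣ approx x n ℚ.- approx y n ∣ ℚ.< ε

fromℚ : ℚ → ℝ
fromℚ q = mkℝ (λ _ → q) λ ε 0<ε →
  0 , λ _ _ _ _ → subst (λ t → ∣ t ∣ ℚ.< ε) (sym (ℚ.+-inverseʳ q)) 0<ε

fromℕ : ℕ → ℝ
fromℕ k = fromℚ (+ k ℚ./ 1)

0ℝ : ℝ
0ℝ = fromℕ 0

module _ where
  open +-*-Solver

  half-pos : ∀ {ε} → 0ℚ ℚ.< ε → 0ℚ ℚ.< ε ℚ.* ½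
  half-pos 0<ε = ℚ.*-monoˡ-<-pos ½ 0<ε

  half+half : ∀ ε → ε ℚ.* ½ ℚ.+ ε ℚ.* ½ ≡ ε
  half+half ε = trans (sym (ℚ.*-distribˡ-+ ε ½ ½)) (ℚ.*-identityʳ ε)

  ∣+∣-bound : ∀ {ε} a b → ∣ a ∣ ℚ.< ε ℚ.* ½ → ∣ b ∣ ℚ.< ε ℚ.* ½ → ∣ a ℚ.+ b ∣ ℚ.< ε
  ∣+∣-bound {ε} a b a< b< = subst (∣ a ℚ.+ b ∣ ℚ.<_) (half+half ε)
    (ℚ.≤-<-trans (ℚ.∣p+q∣≤∣p∣+∣q∣ a b) (ℚ.+-mono-< a< b<))

  ∣*∣-bound : ∀ C .{{_ : Positive C}} {δ} a b → ∣ a ∣ ℚ.≤ C → ∣ b ∣ ℚ.< δ →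
              ∣ a ℚ.* b ∣ ℚ.< C ℚ.* δ
  ∣*∣-bound C {δ} a b a≤C b<δ = begin-strict
    ∣ a ℚ.* b ∣       ≡⟨ ℚ.∣p*q∣≡∣p∣*∣q∣ a b ⟩
    ∣ a ∣ ℚ.* ∣ b ∣   ≤⟨ ℚ.*-monoʳ-≤-nonNeg ∣ b ∣ {{ℚ.nonNegative (ℚ.0≤∣p∣ b)}} a≤C ⟩
    C ℚ.* ∣ b ∣       <⟨ ℚ.*-monoʳ-<-pos C b<δ ⟩
    C ℚ.* δ           ∎
    where open ℚ.≤-Reasoning

  +-cauchy : ∀ x y → IsCauchy x → IsCauchy y → IsCauchy (λ n → x n ℚ.+ y n)
  +-cauchy x y cx cy ε 0<ε =
    let M , hx = cx (ε ℚ.* ½) (half-pos 0<ε)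
        N , hy = cy (ε ℚ.* ½) (half-pos 0<ε)
    in M ⊔ N , λ m n m≥ n≥ →
      subst (λ t → ∣ t ∣ ℚ.< ε) (rearrange (x m) (x n) (y m) (y n))
        (∣+∣-bound {ε} (x m ℚ.- x n) (y m ℚ.- y n)
          (hx m n (ℕ.m⊔n≤o⇒m≤o M N m≥) (ℕ.m⊔n≤o⇒m≤o M N n≥))
          (hy m n (ℕ.m⊔n≤o⇒n≤o M N m≥) (ℕ.m⊔n≤o⇒n≤o M N n≥)))
    where
    rearrange : ∀ a b c d → (a ℚ.- b) ℚ.+ (c ℚ.- d) ≡ (a ℚ.+ c) ℚ.- (b ℚ.+ d)
    rearrange = solve 4 (λ a b c d → (a :- b) :+ (c :- d) := (a :+ c) :- (b :+ d)) refl

  neg-cauchy : ∀ x → IsCauchy x → IsCauchy (λ n → ℚ.- x n)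
  neg-cauchy x cx ε 0<ε =
    let N , hx = cx ε 0<ε
    in N , λ m n m≥ n≥ →
      subst (λ t → ∣ t ∣ ℚ.< ε) (rearrange (x m) (x n)) (hx n m n≥ m≥)
    where
    rearrange : ∀ a b → b ℚ.- a ≡ (ℚ.- a) ℚ.- (ℚ.- b)
    rearrange = solve 2 (λ a b → b :- a := (:- a) :- (:- b)) refl

  eventually-bounded : ∀ {x} → IsCauchy x →
    ∃ λ N → ∃ λ C → 0ℚ ℚ.< C × (∀ n → N ℕ.≤ n → ∣ x n ∣ ℚ.≤ C)
  eventually-bounded {x} cx =
    let N , h = cx 1ℚ (ℚ.positive⁻¹ 1ℚ)
    in N , ∣ x N ∣ ℚ.+ 1ℚ
     , ℚ.+-mono-≤-< (ℚ.0≤∣p∣ (x N)) (ℚ.positive⁻¹ 1ℚ)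
     , λ n n≥ → begin
         ∣ x n ∣                        ≡⟨ cong ∣_∣ (rearrange (x N) (x n)) ⟩
         ∣ x N ℚ.+ (x n ℚ.- x N) ∣      ≤⟨ ℚ.∣p+q∣≤∣p∣+∣q∣ (x N) (x n ℚ.- x N) ⟩
         ∣ x N ∣ ℚ.+ ∣ x n ℚ.- x N ∣    ≤⟨ ℚ.+-monoʳ-≤ ∣ x N ∣ (ℚ.<⇒≤ (h n N n≥ ℕ.≤-refl)) ⟩
         ∣ x N ∣ ℚ.+ 1ℚ                 ∎
    where
    open ℚ.≤-Reasoning
    rearrange : ∀ a b → b ≡ a ℚ.+ (b ℚ.- a)
    rearrange = solve 2 (λ a b → b := a :+ (b :- a)) refl

  scale : ∀ C → 0ℚ ℚ.< C → ∀ ε → 0ℚ ℚ.< ε → ∃ λ δ → 0ℚ ℚ.< δ × C ℚ.* δ ≡ ε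
  scale C 0<C ε 0<ε = 1/C ℚ.* ε , 0<δ , eq
    where
    instance
      C⁺ : Positive C
      C⁺ = ℚ.positive 0<C
      C≠0 : ℚ.NonZero C
      C≠0 = ℚ.pos⇒nonZero C
    1/C : ℚ
    1/C = ℚ.1/ C
    0<δ : 0ℚ ℚ.< 1/C ℚ.* ε
    0<δ = subst (ℚ._< 1/C ℚ.* ε) (ℚ.*-zeroʳ 1/C)
            (ℚ.*-monoʳ-<-pos 1/C {{ℚ.1/pos⇒pos C}} 0<ε)
    eq : C ℚ.* (1/C ℚ.* ε) ≡ ε
    eq = trans (sym (ℚ.*-assoc C 1/C ε))
           (trans (cong (ℚ._* ε) (ℚ.*-inverseʳ C)) (ℚ.*-identityˡ ε))

  *-cauchy : ∀ x y → IsCauchy x → IsCauchy y → IsCauchy (λ n → x n ℚ.* y n)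
  *-cauchy x y cx cy ε 0<ε =
    let Nx , A , 0<A , hA = eventually-bounded cx
        Ny , B , 0<B , hB = eventually-bounded cy
        δy , 0<δy , Aδ≡   = scale A 0<A (ε ℚ.* ½) (half-pos 0<ε)
        δx , 0<δx , Bδ≡   = scale B 0<B (ε ℚ.* ½) (half-pos 0<ε)
        Mx , hx           = cx δx 0<δx
        My , hy           = cy δy 0<δy
        N                 = (Nx ⊔ Ny) ⊔ (Mx ⊔ My)
        ≥N≥ = λ k (k≥ : N ℕ.≤ k) →
          ℕ.m⊔n≤o⇒m≤o (Nx ⊔ Ny) (Mx ⊔ My) k≥ , ℕ.m⊔n≤o⇒n≤o (Nx ⊔ Ny) (Mx ⊔ My) k≥
    in N , λ m n m≥ n≥ →
      let m≥₁ , m≥₂ = ≥N≥ m m≥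
          n≥₁ , n≥₂ = ≥N≥ n n≥
      in subst (λ t → ∣ t ∣ ℚ.< ε) (rearrange (x m) (x n) (y m) (y n))
        (∣+∣-bound {ε} (x m ℚ.* (y m ℚ.- y n)) (y n ℚ.* (x m ℚ.- x n))
          (subst (∣ x m ℚ.* (y m ℚ.- y n) ∣ ℚ.<_) Aδ≡
            (∣*∣-bound A {{ℚ.positive 0<A}} (x m) (y m ℚ.- y n)
              (hA m (ℕ.m⊔n≤o⇒m≤o Nx Ny m≥₁))
              (hy m n (ℕ.m⊔n≤o⇒n≤o Mx My m≥₂) (ℕ.m⊔n≤o⇒n≤o Mx My n≥₂))))
          (subst (∣ y n ℚ.* (x m ℚ.- x n) ∣ ℚ.<_) Bδ≡
            (∣*∣-bound B {{ℚ.positive 0<B}} (y n) (x m ℚ.- x n)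
              (hB n (ℕ.m⊔n≤o⇒n≤o Nx Ny n≥₁))
              (hx m n (ℕ.m⊔n≤o⇒m≤o Mx My m≥₂) (ℕ.m⊔n≤o⇒m≤o Mx My n≥₂)))))
    where
    rearrange : ∀ a b c d →
      a ℚ.* (c ℚ.- d) ℚ.+ d ℚ.* (a ℚ.- b) ≡ a ℚ.* c ℚ.- b ℚ.* d
    rearrange = solve 4 (λ a b c d →
      a :* (c :- d) :+ d :* (a :- b) := a :* c :- b :* d) refl

infixl 6 _+_ _-_
infixl 7 _*_

neg : ℝ → ℝ
neg x = mkℝ (λ n → ℚ.- approx x n) (neg-cauchy (approx x) (cauchy x))

_+_ _*_ _-_ : ℝ → ℝ → ℝ
x + y = mkℝ (λ n → approx x n ℚ.+ approx y n) (+-cauchy (approx x) (approx y) (cauchy x) (cauchy y))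
x * y = mkℝ (λ n → approx x n ℚ.* approx y n) (*-cauchy (approx x) (approx y) (cauchy x) (cauchy y))
x - y = x + neg y

Matrix : ℕ → Set
Matrix n = Fin n → Fin n → ℝ

∑ : ∀ {r} → Vector ℝ r → ℝ
∑ = foldr _+_ 0ℝ

-- ‖ v ‖² is the square of the Euclidean norm √(∑ₖ vₖ²), written without the root.
‖_‖² : ∀ {r} → Vector ℝ r → ℝ
‖ v ‖² = ∑ (λ k → v k * v k)

_⊖_ : ∀ {r} → Vector ℝ r → Vector ℝ r → Vector ℝ r
(v ⊖ w) k = v k - w k

IsEuclideanDistanceMatrix : ∀ {n} → Matrix n → Set
IsEuclideanDistanceMatrix {n} M =
  ∃ λ r → Σ (Fin n → Vector ℝ r) λ x → ∀ i j → M i j ≈ ‖ x i ⊖ x j ‖²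

-- Decidability of adjacency makes distances computable; for a finite graph
-- it is automatic classically.
record SimpleGraph (n : ℕ) : Set₁ where
  field
    Adj     : Rel (Fin n) 0ℓ
    adj?    : Decidable Adj
    adj-sym : Symmetric Adj
    irrefl  : Irreflexive _≡_ Adj

module _ {n} (G : SimpleGraph n) where
  open SimpleGraph G

  -- A path of length k is its sequence of k + 1 distinct vertices.
  IsPath : ∀ {k} → Fin n → Fin n → Vec (Fin n) (suc k) → Set
  IsPath u v p = Vec.head p ≡ u × Vec.last p ≡ v × Linked Adj p × Unique p

  Path : Fin n → Fin n → ℕ → Set
  Path u v k = Σ (Vec (Fin n) (suc k)) (IsPath u v)

  Connected : Set
  Connected = ∀ u v → ∃ (Path u v)

  IsDistance : Fin n → Fin n → ℕ → Set
  IsDistance u v k = Path u v k × (∀ l → Path u v l → k ℕ.≤ l)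

record ConnectedGraph (n : ℕ) : Set₁ where
  field
    graph     : SimpleGraph n
    connected : Connected graph

  open SimpleGraph graph public

anyVec? : ∀ {n} k {P : Vec (Fin n) k → Set} → (∀ p → Dec (P p)) → Dec (∃ P)
anyVec? zero    P? = map′ ([] ,_) (λ { ([] , h) → h }) (P? [])
anyVec? (suc k) P? =
  map′ (λ { (i , p , h) → i ∷ p , h }) (λ { (i ∷ p , h) → i , p , h })
       (Fin.any? λ i → anyVec? k λ p → P? (i ∷ p))

path? : ∀ {n} (G : SimpleGraph n) u v k → Dec (Path G u v k)
path? G u v k = anyVec? (suc k) λ p →
  Vec.head p Fin.≟ u ×-dec Vec.last p Fin.≟ v ×-dec
  linked? (SimpleGraph.adj? G) p ×-dec allPairs? (λ i j → ¬? (i Fin.≟ j)) p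

least : ∀ {P : ℕ → Set} → (∀ k → Dec (P k)) → ∀ k → P k →
        ∃ λ m → P m × (∀ l → P l → m ℕ.≤ l)
least P? zero    h = zero , h , λ _ _ → ℕ.z≤n
least P? (suc k) h with P? zero
... | yes h₀ = zero , h₀ , λ _ _ → ℕ.z≤n
... | no ¬h₀ with least (λ l → P? (suc l)) k h
...   | m , hm , min = suc m , hm , λ where
        zero    h₀ → ⊥-elim (¬h₀ h₀)
        (suc l) hl → s≤s (min l hl)

module _ {n} (G : ConnectedGraph n) where
  open ConnectedGraph G

  distance : ∀ u v → ∃ (IsDistance graph u v)
  distance u v = let k , p = connected u v in least (path? graph u v) k p

  d : Fin n → Fin n → ℕ
  d u v = proj₁ (distance u v)

  -- The base value 0 is harmless: d v v is 0.
  ecc : Fin n → ℕ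
  ecc v = max 0 (tabulate (d v))

  eccentricityMatrix : Matrix n
  eccentricityMatrix i j =
    if ⌊ d i j ℕ.≟ ecc i ⊓ ecc j ⌋ then fromℕ (d i j) else 0ℝ

-- b follows a in the cyclic order on Fin m.
Next : ∀ {m} → Rel (Fin m) 0ℓ
Next {m} a b = suc (toℕ a) ≡ toℕ b ⊎ (suc (toℕ a) ≡ m × toℕ b ≡ 0)

next? : ∀ {m} → Decidable (Next {m})
next? {m} a b =
  suc (toℕ a) ℕ.≟ toℕ b ⊎-dec (suc (toℕ a) ℕ.≟ m ×-dec toℕ b ℕ.≟ 0)

next-irrefl : ∀ {m} → 3 ℕ.≤ m → (a : Fin m) → ¬ Next a a
next-irrefl 3≤m a (inj₁ eq)       = ℕ.1+n≢n eq
next-irrefl 3≤m a (inj₂ (eq , z)) =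
  ℕ.<⇒≱ 3≤m (ℕ.≤-trans (ℕ.≤-reflexive (trans (sym eq) (cong suc z))) (ℕ.n≤1+n 1))

cycle : ∀ m → 3 ℕ.≤ m → SimpleGraph m
cycle m 3≤m = record
  { Adj     = λ a b → Next a b ⊎ Next b a
  ; adj?    = λ a b → next? a b ⊎-dec next? b a
  ; adj-sym = swap
  ; irrefl  = λ where
      refl (inj₁ h) → next-irrefl 3≤m _ h
      refl (inj₂ h) → next-irrefl 3≤m _ h
  }

-- zero is the new vertex; suc a is the vertex a of G.
data ConeAdj {m} (G : SimpleGraph m) : Rel (Fin (suc m)) 0ℓ where
  hub-rim : ∀ {a}   → ConeAdj G zero (suc a)
  rim-hub : ∀ {a}   → ConeAdj G (suc a) zero
  rim-rim : ∀ {a b} → SimpleGraph.Adj G a b → ConeAdj G (suc a) (suc b)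

cone : ∀ {m} → SimpleGraph m → ConnectedGraph (suc m)
cone {m} G = record { graph = graph ; connected = connected }
  where
  open SimpleGraph G

  graph : SimpleGraph (suc m)
  graph = record
    { Adj     = ConeAdj G
    ; adj?    = λ where
        zero    zero    → no λ ()
        zero    (suc b) → yes hub-rim
        (suc a) zero    → yes rim-hub
        (suc a) (suc b) → map′ rim-rim (λ { (rim-rim h) → h }) (adj? a b)
    ; adj-sym = λ where
        hub-rim     → rim-hub
        rim-hub     → hub-rim
        (rim-rim h) → rim-rim (adj-sym h)
    ; irrefl  = λ where
        refl (rim-rim h) → irrefl refl h
    }

  connected : Connected graph
  connected u v with u Fin.≟ v
  ... | yes u≡v = 0 , u ∷ [] , refl , u≡v , [-] , [] ∷ []
  connected zero    zero    | no u≢v = ⊥-elim (u≢v refl)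
  connected zero    (suc b) | no u≢v =
    1 , zero ∷ suc b ∷ [] , refl , refl , hub-rim ∷ [-] , (u≢v ∷ []) ∷ [] ∷ []
  connected (suc a) zero    | no u≢v =
    1 , suc a ∷ zero ∷ [] , refl , refl , rim-hub ∷ [-] , (u≢v ∷ []) ∷ [] ∷ []
  connected (suc a) (suc b) | no u≢v =
    2 , suc a ∷ zero ∷ suc b ∷ [] , refl , refl , rim-hub ∷ hub-rim ∷ [-]
      , ((λ ()) ∷ u≢v ∷ []) ∷ ((λ ()) ∷ []) ∷ [] ∷ []

-- n counts the hub, so the cycle has n - 1 ≥ 3 vertices.
wheel : ∀ n → 4 ℕ.≤ n → ConnectedGraph n
wheel (suc m) (s≤s 3≤m) = cone (cycle m 3≤m)

{-# OPTIONS --safe #-}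
-- Rim vertices of a wheel with at least four of them have eccentricity 2, so
-- the entry of the eccentricity matrix is 0 at adjacent rim vertices and 2 at
-- non-adjacent ones.  A Euclidean embedding would thus send consecutive rim
-- vertices to the same point, yet separate the first from the third.
module Submission where

open import Defs
open import Data.Nat using (ℕ; _≤_)
open import Data.Nat.Properties using (<⇒≤)
open import Relation.Nullary using (¬_)

open import Data.Bool using (if_then_else_)
open import Data.Empty using (⊥-elim)
open import Data.Fin using (Fin; zero; suc; _≟_)
open import Data.List.Extrema.Nat using (xs≤max; max≤v⁺)
import Data.List.Relation.Unary.All.Properties as All
open import Data.Nat using (suc; _<_; _⊓_; _⊔_; z≤n; s≤s)
import Data.Nat.Properties as ℕ
open import Data.Product using (_,_; proj₁; proj₂)
open import Data.Rational as ℚ using (ℚ; 0ℚ; 1ℚ; ½)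
import Data.Rational.Properties as ℚ
open import Data.Rational.Solver using (module +-*-Solver)
open import Data.Sum using (inj₁; inj₂)
open import Data.Vec using ([]; _∷_)
open import Data.Vec.Functional using (Vector; head; tail)
open import Data.Vec.Relation.Unary.All using ([]; _∷_)
open import Data.Vec.Relation.Unary.AllPairs using ([]; _∷_)
open import Data.Vec.Relation.Unary.Linked using ([-]; _∷_)
open import Relation.Binary.PropositionalEquality
open import Relation.Nullary using (Dec; yes; no)
open import Relation.Nullary.Decidable using (dec-true; dec-false; isYes≗does)

≈-sym : ∀ {x y} → x ≈ y → y ≈ x
≈-sym {x} {y} x≈y ε 0<ε =
  let N , h = x≈y ε 0<ε
  in N , λ n n≥ → subst (ℚ._< ε) (∣-∣-comm (approx x n) (approx y n)) (h n n≥)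
  where
  open +-*-Solver
  ∣-∣-comm : ∀ a b → ℚ.∣ a ℚ.- b ∣ ≡ ℚ.∣ b ℚ.- a ∣
  ∣-∣-comm a b = trans (sym (ℚ.∣-p∣≡∣p∣ (a ℚ.- b)))
    (cong ℚ.∣_∣ (solve 2 (λ a b → :- (a :- b) := b :- a) refl a b))

≈-trans : ∀ {x y z} → x ≈ y → y ≈ z → x ≈ z
≈-trans {x} {y} {z} x≈y y≈z ε 0<ε =
  let M , h = x≈y (ε ℚ.* ½) (half-pos 0<ε)
      N , k = y≈z (ε ℚ.* ½) (half-pos 0<ε)
  in M ⊔ N , λ n n≥ →
    subst (λ t → ℚ.∣ t ∣ ℚ.< ε) (telescope (approx x n) (approx y n) (approx z n))
      (∣+∣-bound {ε} (approx x n ℚ.- approx y n) (approx y n ℚ.- approx z n)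
        (h n (ℕ.m⊔n≤o⇒m≤o M N n≥)) (k n (ℕ.m⊔n≤o⇒n≤o M N n≥)))
  where
  open +-*-Solver
  telescope : ∀ a b c → (a ℚ.- b) ℚ.+ (b ℚ.- c) ≡ a ℚ.- c
  telescope = solve 3 (λ a b c → (a :- b) :+ (b :- c) := a :- c) refl

fromℕ2≉0 : ¬ fromℕ 2 ≈ 0ℝ
fromℕ2≉0 2≈0 =
  -- Both sequences are constant, so tolerance 1 already gives 2 < 1.
  let N , h = 2≈0 1ℚ (ℚ.positive⁻¹ 1ℚ)
  in ℚ.<-asym (h N ℕ.≤-refl) (ℚ.+-monoʳ-< 1ℚ (ℚ.positive⁻¹ 1ℚ))

square-nonneg : ∀ q → 0ℚ ℚ.≤ q ℚ.* q
square-nonneg q with ℚ.≤-total 0ℚ q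
... | inj₁ 0≤q = ℚ.nonNegative⁻¹ (q ℚ.* q) {{ℚ.nonNeg*nonNeg⇒nonNeg q {{q≥0}} q {{q≥0}}}}
  where q≥0 = ℚ.nonNegative 0≤q
... | inj₂ q≤0 = ℚ.nonNegative⁻¹ (q ℚ.* q) {{ℚ.nonPos*nonPos⇒nonPos q {{q≤0′}} q {{q≤0′}}}}
  where q≤0′ = ℚ.nonPositive q≤0

p≤p+q : ∀ p {q} → 0ℚ ℚ.≤ q → p ℚ.≤ p ℚ.+ q
p≤p+q p {q} 0≤q = subst (ℚ._≤ p ℚ.+ q) (ℚ.+-identityʳ p) (ℚ.+-monoʳ-≤ p 0≤q)

double : ℚ → ℚ
double p = p ℚ.+ p

-- A substitute for the triangle inequality without square roots. With p = a - b and q = b - c, the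
-- gap between the two sides is (p - q)², by the parallelogram law.
square-triangle : ∀ a b c →
  (a ℚ.- c) ℚ.* (a ℚ.- c) ℚ.≤
  double ((a ℚ.- b) ℚ.* (a ℚ.- b) ℚ.+ (b ℚ.- c) ℚ.* (b ℚ.- c))
square-triangle a b c =
  subst ((a ℚ.- c) ℚ.* (a ℚ.- c) ℚ.≤_) (parallelogram a b c)
    (p≤p+q _ (square-nonneg ((a ℚ.- b) ℚ.- (b ℚ.- c))))
  where
  open +-*-Solver
  parallelogram : ∀ a b c →
    (a ℚ.- c) ℚ.* (a ℚ.- c) ℚ.+ ((a ℚ.- b) ℚ.- (b ℚ.- c)) ℚ.* ((a ℚ.- b) ℚ.- (b ℚ.- c))
    ≡ double ((a ℚ.- b) ℚ.* (a ℚ.- b) ℚ.+ (b ℚ.- c) ℚ.* (b ℚ.- c))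
  parallelogram = solve 3 (λ a b c →
    (a :- c) :* (a :- c) :+ ((a :- b) :- (b :- c)) :* ((a :- b) :- (b :- c))
    := ((a :- b) :* (a :- b) :+ (b :- c) :* (b :- c))
       :+ ((a :- b) :* (a :- b) :+ (b :- c) :* (b :- c))) refl

∑-nonneg : ∀ {r} (f : Vector ℝ r) n → (∀ k → 0ℚ ℚ.≤ approx (f k) n) → 0ℚ ℚ.≤ approx (∑ f) n
∑-nonneg {0}     f n f≥0 = ℚ.≤-refl
∑-nonneg {suc r} f n f≥0 = ℚ.≤-trans (f≥0 zero)
  (p≤p+q (approx (head f) n) (∑-nonneg (tail f) n λ k → f≥0 (suc k)))

‖‖²-nonneg : ∀ {r} (v : Vector ℝ r) n → 0ℚ ℚ.≤ approx ‖ v ‖² n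
‖‖²-nonneg v n = ∑-nonneg (λ k → v k * v k) n λ k → square-nonneg (approx (v k) n)

-- Working at one fixed index of the approximating sequences reduces sums of reals to sums of
-- rationals, so no order on `ℝ` has to be set up.
∑-mono-double : ∀ {r} (f g h : Vector ℝ r) n →
  (∀ k → approx (f k) n ℚ.≤ double (approx (g k) n ℚ.+ approx (h k) n)) →
  approx (∑ f) n ℚ.≤ double (approx (∑ g) n ℚ.+ approx (∑ h) n)
∑-mono-double {0}     f g h n f≤ = ℚ.≤-refl
∑-mono-double {suc r} f g h n f≤ = subst (approx (∑ f) n ℚ.≤_)
  (rearrange (approx (head g) n) (approx (head h) n) (approx (∑ (tail g)) n) (approx (∑ (tail h)) n))
  (ℚ.+-mono-≤ {approx (head f) n} (f≤ zero)
    (∑-mono-double (tail f) (tail g) (tail h) n λ k → f≤ (suc k)))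
  where
  open +-*-Solver
  rearrange : ∀ a b c d → double (a ℚ.+ b) ℚ.+ double (c ℚ.+ d) ≡ double ((a ℚ.+ c) ℚ.+ (b ℚ.+ d))
  rearrange = solve 4 (λ a b c d → ((a :+ b) :+ (a :+ b)) :+ ((c :+ d) :+ (c :+ d))
    := ((a :+ c) :+ (b :+ d)) :+ ((a :+ c) :+ (b :+ d))) refl

‖‖²-triangle : ∀ {r} (u v w : Vector ℝ r) n →
  approx ‖ u ⊖ w ‖² n ℚ.≤ double (approx ‖ u ⊖ v ‖² n ℚ.+ approx ‖ v ⊖ w ‖² n)
‖‖²-triangle u v w n = ∑-mono-double
  (λ k → (u ⊖ w) k * (u ⊖ w) k) (λ k → (u ⊖ v) k * (u ⊖ v) k) (λ k → (v ⊖ w) k * (v ⊖ w) k) n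
  λ k → square-triangle (approx (u k) n) (approx (v k) n) (approx (w k) n)

‖‖²-null-trans : ∀ {r} (u v w : Vector ℝ r) →
  ‖ u ⊖ v ‖² ≈ 0ℝ → ‖ v ⊖ w ‖² ≈ 0ℝ → ‖ u ⊖ w ‖² ≈ 0ℝ
‖‖²-null-trans u v w uv≈0 vw≈0 ε 0<ε =
  -- A quarter of ε for each squared distance: their sum stays below ε / 2, and its double below ε.
  let M , h = uv≈0 (ε ℚ.* ½ ℚ.* ½) (half-pos (half-pos 0<ε))
      N , k = vw≈0 (ε ℚ.* ½ ℚ.* ½) (half-pos (half-pos 0<ε))
  in M ⊔ N , λ n n≥ →
    let uv = approx ‖ u ⊖ v ‖² n
        vw = approx ‖ v ⊖ w ‖² n
        uv+vw< : uv ℚ.+ vw ℚ.< ε ℚ.* ½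
        uv+vw< = subst (uv ℚ.+ vw ℚ.<_) (half+half (ε ℚ.* ½)) (ℚ.+-mono-<
          (drop-abs (‖‖²-nonneg (u ⊖ v) n) (h n (ℕ.m⊔n≤o⇒m≤o M N n≥)))
          (drop-abs (‖‖²-nonneg (v ⊖ w) n) (k n (ℕ.m⊔n≤o⇒n≤o M N n≥))))
    in add-abs (‖‖²-nonneg (u ⊖ w) n) (ℚ.≤-<-trans (‖‖²-triangle u v w n)
         (subst (double (uv ℚ.+ vw) ℚ.<_) (half+half ε) (ℚ.+-mono-< uv+vw< uv+vw<)))
  where
  ∣p-0∣≡p : ∀ {p} → 0ℚ ℚ.≤ p → ℚ.∣ p ℚ.- 0ℚ ∣ ≡ p
  ∣p-0∣≡p {p} 0≤p = trans (cong ℚ.∣_∣ (ℚ.+-identityʳ p)) (ℚ.0≤p⇒∣p∣≡p 0≤p)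
  drop-abs : ∀ {p δ} → 0ℚ ℚ.≤ p → ℚ.∣ p ℚ.- 0ℚ ∣ ℚ.< δ → p ℚ.< δ
  drop-abs {δ = δ} 0≤p = subst (ℚ._< δ) (∣p-0∣≡p 0≤p)
  add-abs : ∀ {p δ} → 0ℚ ℚ.≤ p → p ℚ.< δ → ℚ.∣ p ℚ.- 0ℚ ∣ ℚ.< δ
  add-abs {δ = δ} 0≤p = subst (ℚ._< δ) (sym (∣p-0∣≡p 0≤p))

-- This is the obstruction used against wheels: a zero entry means that two points of the embedding
-- coincide.
EDM-null-trans : ∀ {n} {M : Matrix n} → IsEuclideanDistanceMatrix M →
  ∀ i j k → M i j ≈ 0ℝ → M j k ≈ 0ℝ → M i k ≈ 0ℝ
EDM-null-trans {M = M} (r , x , eq) i j k ij≈0 jk≈0 =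
  ≈-trans {M i k} {‖ x i ⊖ x k ‖²} {0ℝ} (eq i k)
    (‖‖²-null-trans (x i) (x j) (x k) (null i j ij≈0) (null j k jk≈0))
  where
  null : ∀ i j → M i j ≈ 0ℝ → ‖ x i ⊖ x j ‖² ≈ 0ℝ
  null i j = ≈-trans {‖ x i ⊖ x j ‖²} {M i j} {0ℝ} (≈-sym {M i j} {‖ x i ⊖ x j ‖²} (eq i j))

module _ {n} (G : ConnectedGraph n) where
  open ConnectedGraph G

  d≤length : ∀ u v {k} → Path graph u v k → d G u v ≤ k
  d≤length u v p = proj₂ (proj₂ (distance G u v)) _ p

  adjacent⇒d≤1 : ∀ u v → Adj u v → d G u v ≤ 1
  adjacent⇒d≤1 u v uv =
    d≤length u v (u ∷ v ∷ [] , refl , refl , uv ∷ [-] , ((λ u≡v → irrefl u≡v uv) ∷ []) ∷ [] ∷ [])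

  -- A shortest path of length 0 would identify the endpoints, and one of length 1 would be an edge
  -- between them.
  nonadjacent⇒2≤d : ∀ u v → u ≢ v → ¬ Adj u v → 2 ≤ d G u v
  nonadjacent⇒2≤d u v u≢v ¬uv with d G u v | proj₁ (proj₂ (distance G u v))
  ... | 0           | _ ∷ []     , refl , refl , _          = ⊥-elim (u≢v refl)
  ... | 1           | _ ∷ _ ∷ [] , refl , refl , uv ∷ _ , _ = ⊥-elim (¬uv uv)
  ... | suc (suc _) | _                                     = s≤s (s≤s z≤n)

  d≤ecc : ∀ u v → d G u v ≤ ecc G u
  d≤ecc u = All.tabulate⁻ (xs≤max 0 _)

  ecc≤ : ∀ {k} u → (∀ v → d G u v ≤ k) → ecc G u ≤ k
  -- `z≤n` accounts for the base value 0 of `max`.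
  ecc≤ u h = max≤v⁺ z≤n (All.tabulate⁺ h)

  entry-attained : ∀ i j → d G i j ≡ ecc G i ⊓ ecc G j →
    eccentricityMatrix G i j ≡ fromℕ (d G i j)
  entry-attained i j eq = cong (if_then fromℕ (d G i j) else 0ℝ)
    -- `⌊_⌋` is `isYes`, whereas `dec-true` speaks about `does`.
    (trans (isYes≗does (d G i j ℕ.≟ ecc G i ⊓ ecc G j)) (dec-true (d G i j ℕ.≟ ecc G i ⊓ ecc G j) eq))

  entry-missed : ∀ i j → d G i j < ecc G i ⊓ ecc G j →
    eccentricityMatrix G i j ≡ 0ℝ
  entry-missed i j lt = cong (if_then fromℕ (d G i j) else 0ℝ)
    (trans (isYes≗does (d G i j ℕ.≟ ecc G i ⊓ ecc G j)) (dec-false (d G i j ℕ.≟ ecc G i ⊓ ecc G j) (ℕ.<⇒≢ lt)))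

module _ {m} (G : SimpleGraph m) where
  open SimpleGraph G

  private E = eccentricityMatrix (cone G)

  -- Such a vertex lifts the eccentricity of `a` in the cone to 2; a rim vertex adjacent to all
  -- others would have eccentricity 1.
  record NonNeighbour (a : Fin m) : Set where
    constructor nonNeighbour
    field
      {vertex} : Fin m
      distinct : a ≢ vertex
      ¬adj     : ¬ Adj a vertex

  rim-2≤d : ∀ a b → a ≢ b → ¬ Adj a b → 2 ≤ d (cone G) (suc a) (suc b)
  rim-2≤d a b a≢b ¬ab = nonadjacent⇒2≤d (cone G) (suc a) (suc b)
    (λ { refl → a≢b refl }) λ { (rim-rim ab) → ¬ab ab }

  rim-d≤2 : ∀ a v → d (cone G) (suc a) v ≤ 2
  rim-d≤2 a zero    = ℕ.≤-trans (adjacent⇒d≤1 (cone G) (suc a) zero rim-hub) (ℕ.n≤1+n 1)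
  -- The detour through the hub is a path only if its ends differ, since path vertices are distinct.
  rim-d≤2 a (suc b) = bound (a ≟ b)
    where
    bound : Dec (a ≡ b) → d (cone G) (suc a) (suc b) ≤ 2
    bound (yes refl) = ℕ.≤-trans
      (d≤length (cone G) (suc a) (suc a) (suc a ∷ [] , refl , refl , [-] , [] ∷ [])) z≤n
    bound (no a≢b)   = d≤length (cone G) (suc a) (suc b)
      ( suc a ∷ zero ∷ suc b ∷ [] , refl , refl , rim-hub ∷ hub-rim ∷ [-]
      , ((λ ()) ∷ (λ { refl → a≢b refl }) ∷ []) ∷ ((λ ()) ∷ []) ∷ [] ∷ [])

  rim-ecc : ∀ {a} → NonNeighbour a → ecc (cone G) (suc a) ≡ 2
  rim-ecc {a} (nonNeighbour {b} a≢b ¬ab) = ℕ.≤-antisym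
    (ecc≤ (cone G) (suc a) (rim-d≤2 a))
    (ℕ.≤-trans (rim-2≤d a b a≢b ¬ab) (d≤ecc (cone G) (suc a) (suc b)))

  -- The distance is at most 1, while both eccentricities are 2.
  rim-adjacent-entry : ∀ {a b} → NonNeighbour a → NonNeighbour b → Adj a b →
    E (suc a) (suc b) ≡ 0ℝ
  rim-adjacent-entry {a} {b} na nb ab = entry-missed (cone G) (suc a) (suc b)
    (subst (d (cone G) (suc a) (suc b) <_) (sym (cong₂ _⊓_ (rim-ecc na) (rim-ecc nb)))
      (s≤s (adjacent⇒d≤1 (cone G) (suc a) (suc b) (rim-rim ab))))

  -- Each vertex is a non-neighbour of the other, so both eccentricities are 2 and the distance
  -- attains their minimum.
  rim-nonadjacent-entry : ∀ {a b} → a ≢ b → ¬ Adj a b → E (suc a) (suc b) ≡ fromℕ 2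
  rim-nonadjacent-entry {a} {b} a≢b ¬ab = trans
    (entry-attained (cone G) (suc a) (suc b) (trans d≡2 (sym (cong₂ _⊓_
      (rim-ecc (nonNeighbour a≢b ¬ab))
      (rim-ecc (nonNeighbour (≢-sym a≢b) λ ba → ¬ab (adj-sym ba)))))))
    (cong fromℕ d≡2)
    where
    d≡2 : d (cone G) (suc a) (suc b) ≡ 2
    d≡2 = ℕ.≤-antisym (rim-d≤2 a (suc b)) (rim-2≤d a b a≢b ¬ab)

  -- Zero entries at `a`, `b` and at `b`, `c` would force one at `a`, `c`, where the entry is 2. The
  -- ends are non-neighbours of each other; only the middle vertex takes its non-neighbour from
  -- outside.
  cone-not-EDM : ∀ {a b c} → Adj a b → Adj b c → a ≢ c → ¬ Adj a c → NonNeighbour b →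
    ¬ IsEuclideanDistanceMatrix E
  cone-not-EDM {a} {b} {c} ab bc a≢c ¬ac nb edm =
    fromℕ2≉0 (subst (_≈ 0ℝ) (rim-nonadjacent-entry a≢c ¬ac)
      (EDM-null-trans {M = E} edm (suc a) (suc b) (suc c)
        (≡0⇒≈0 (rim-adjacent-entry na nb ab))
        (≡0⇒≈0 (rim-adjacent-entry nb nc bc))))
    where
    na : NonNeighbour a
    na = nonNeighbour a≢c ¬ac
    nc : NonNeighbour c
    nc = nonNeighbour (≢-sym a≢c) λ ca → ¬ac (adj-sym ca)
    ≡0⇒≈0 : ∀ {x} → x ≡ 0ℝ → x ≈ 0ℝ
    ≡0⇒≈0 refl ε 0<ε = 0 , λ _ _ → 0<ε

-- With an arbitrary proof of 4 ≤ n, matching on it unfolds `wheel` to a cone over a cycle.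
wheel-not-EDM : ∀ n (4≤n : 4 ≤ n) → 5 ≤ n →
  ¬ IsEuclideanDistanceMatrix (eccentricityMatrix (wheel n 4≤n))
wheel-not-EDM (suc m) (s≤s 3≤m) (s≤s (s≤s (s≤s (s≤s (s≤s z≤n))))) =
  cone-not-EDM (cycle m 3≤m) {zero} {suc zero} {suc (suc zero)}
    (inj₁ (inj₁ refl)) (inj₁ (inj₁ refl)) (λ ())
    -- The last case is the step from 2 around to 0, impossible as m ≥ 4; in a triangle it would be
    -- an edge.
    (λ { (inj₁ (inj₁ ())) ; (inj₁ (inj₂ (() , _))) ; (inj₂ (inj₁ ())) ; (inj₂ (inj₂ (() , _))) })
    -- Vertex 3 exists because m ≥ 4. It may be the last one, but then its successor is 0, not 1, so
    -- the last case fails in its second component.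
    (nonNeighbour {vertex = suc (suc (suc zero))} (λ ())
      λ { (inj₁ (inj₁ ())) ; (inj₁ (inj₂ (() , _))) ; (inj₂ (inj₁ ())) ; (inj₂ (inj₂ (_ , ()))) })

proposition2p5 : ∀ (n : ℕ) (5≤n : 5 ≤ n) →
    ¬ IsEuclideanDistanceMatrix (eccentricityMatrix (wheel n (<⇒≤ 5≤n)))
proposition2p5 n 5≤n = wheel-not-EDM n (<⇒≤ 5≤n) 5≤n
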